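{- For every integer $b \ge 2$, the base-$b$ child graph $G_c$ contains an infinite path; that is, there is an infinite sequence of positive integers $a(1), a(2), a(3), \ldots$ such that $a(n+1)$ is a comma-child of $a(n)$ in base $b$ for every $n \ge 1$.
   Context: Fix a base $b \ge 2$. For a positive integer $n$, let $\delta(n)$ denote its leading (most significant, nonzero) base-$b$ digit. For positive integers $k, k'$, we say that $k'$ is a comma-child of $k$ (in base $b$) if $k' - k = d\cdot b + \delta(k')$, where $d = k \bmod b$ is the last base-$b$ digit of $k$. The child graph $G_c$ (in base $b$) is the directed graph whose nodes are the positive integers, with an edge from $i$ to $j$ exactly when $j$ is a comma-child of $i$. Paths are directed paths. -}

module Defs where

open import Data.Digit using (Digit; Expansion; fromDigits)
open import Data.Fin.Base using (toℕ)
open import Data.List.Base using (_∷ʳ_)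
open import Data.Nat.Base using (ℕ; suc; _+_; _*_; _%_; NonZero; NonTrivial; nonTrivial⇒nonZero)
open import Data.Product.Base using (∃; ∃-syntax; Σ-syntax; _×_; _,_)
open import Level using (Level; _⊔_; 0ℓ)
open import Relation.Binary.Core using (Rel)
open import Relation.Binary.PropositionalEquality.Core using (_≡_)

private
  variable
    a ℓ : Level

ℕ⁺ : Set
ℕ⁺ = ∃ NonZero

-- LeadingDigit b n e says that δ(n) = e in base b.  Expansions list the
-- least significant digit first, so the leading digit is the last entry.

LeadingDigit : (b : ℕ) → ℕ → Digit b → Set
LeadingDigit b n e =
  NonZero (toℕ e) × (Σ[ ds ∈ Expansion b ] fromDigits (ds ∷ʳ e) ≡ n)

-- CommaChild b k k′ says that k′ is a comma-child of k.  The condition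
-- k′ - k = d * b + δ(k′) is written additively, since _∸_ truncates.

CommaChild : (b : ℕ) → .{{NonTrivial b}} → ℕ → ℕ → Set
CommaChild b k k′ =
  ∃[ e ] LeadingDigit b k′ e × k′ ≡ k + ((k % b) * b + toℕ e)
  where
  instance
    b≢0 : NonZero b
    b≢0 = nonTrivial⇒nonZero b

-- A directed graph is given by its edge relation: there is an edge from
-- i to j exactly when the relation holds of i and j.

ChildGraph : (b : ℕ) → .{{NonTrivial b}} → Rel ℕ⁺ 0ℓ
ChildGraph b (i , _) (j , _) = CommaChild b i j

InfinitePath : {A : Set a} → Rel A ℓ → Set (a ⊔ ℓ)
InfinitePath {A = A} _⟶_ = Σ[ p ∈ (ℕ → A) ] (∀ n → p n ⟶ p (suc n))

{-# OPTIONS --safe #-}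

-- A constructive substitute for König's lemma.  While the leading digit e is
-- constant, b steps leave the last digit unchanged and add a constant
-- l ≤ b³, so any multiple of M = (b³)! can be inserted into a path.  Every
-- y ≥ b² has a parent x > y - b², so walking back from a large number meets
-- [bᵏ , bᵏ + b²) for all smaller k; by the pigeonhole principle some path leads
-- from bⁿ + s to bⁿ⁺ᴾ + s with bⁿ⁺ᴾ ≡ bⁿ modulo M.  Moving numbers of the form
-- (e + 1) bᵐ - r to (e + 1) bᵐ⁺ᴾ - r sends edges to paths, the excess
-- bᵐ⁺ᴾ - bᵐ being a multiple of M, and bⁿ + s reaches its own image.  This
-- property of a number is inherited by its successor on the path to the image,
-- so one can keep walking.

module Submission where

open import Defs
open import Data.Digit using (Digit; Expansion; fromDigits)
open import Data.Fin.Base using (Fin; toℕ; fromℕ<; combine)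
open import Data.Fin.Properties
  using (pigeonhole; combine-injective; fromℕ<-injective; toℕ-fromℕ<; toℕ≤pred[n])
open import Data.List.Base using ([]; _∷_; _∷ʳ_)
open import Data.Nat.Base
open import Data.Nat.DivMod
open import Data.Nat.Divisibility
open import Data.Nat.GeneralisedArithmetic using (fold; fold-+)
open import Data.Nat.Induction using (<-wellFounded)
open import Data.Nat.Properties
open import Data.Nat.Tactic.RingSolver using (solve-∀)
open import Data.Product.Base using (∃; ∃-syntax; Σ-syntax; _×_; _,_; proj₁; proj₂)
open import Data.Sum.Base using (inj₁; inj₂)
open import Induction.WellFounded using (Acc; acc)
open import Relation.Binary.Construct.Closure.ReflexiveTransitive using (Star; ε; _◅_; _◅◅_)
open import Relation.Binary.PropositionalEquality
open import Relation.Nullary using (yes; no; contradiction)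

-- Divisibility by factorials and from equal residues.

n∣n! : ∀ n .{{_ : NonZero n}} → n ∣ n !
n∣n! (suc n) = m∣m*n (n !)

m≤n⇒m∣n! : ∀ {m n} .{{_ : NonZero m}} → m ≤ n → m ∣ n !
m≤n⇒m∣n! {m} m≤n = ∣-trans (n∣n! m) (m≤n⇒m!∣n! m≤n)

[m+n]%d≡m%d⇒d∣n : ∀ m n d .{{_ : NonZero d}} → (m + n) % d ≡ m % d → d ∣ n
[m+n]%d≡m%d⇒d∣n m n d eq = ∣m+n∣m⇒∣n (divides ((m + n) / d) (+-cancelˡ-≡ (m % d) _ _ (begin
  m % d + (m / d * d + n)        ≡⟨ +-assoc (m % d) _ n ⟨
  m % d + m / d * d + n          ≡⟨ cong (_+ n) (m≡m%n+[m/n]*n m d) ⟨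
  m + n                          ≡⟨ m≡m%n+[m/n]*n (m + n) d ⟩
  (m + n) % d + (m + n) / d * d  ≡⟨ cong (_+ (m + n) / d * d) eq ⟩
  m % d + (m + n) / d * d        ∎))) (divides-refl (m / d))
  where open ≡-Reasoning

module _ (b : ℕ) .{{_ : NonTrivial b}} where

  private instance
    b≢0 : NonZero b
    b≢0 = nonTrivial⇒nonZero b

  -- Numbers with `m + 1` digits and leading digit `e`, described by inequalities.

  record Block (m e x : ℕ) : Set where
    constructor block
    field
      positive : 0 < e
      digit    : e < b
      lower    : e * b ^ m ≤ x
      upper    : x < suc e * b ^ m

  open Block

  b^m>0 : ∀ m → 0 < b ^ m
  b^m>0 m = m^n>0 b m

  block⇒nonZero : ∀ {m e x} → Block m e x → NonZero x
  block⇒nonZero {m} bx = >-nonZero (<-≤-trans (*-mono-< (positive bx) (b^m>0 m)) (lower bx))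

  block-exists : ∀ x .{{_ : NonZero x}} → ∃[ m ] ∃[ e ] Block m e x
  block-exists x = go x (<-wellFounded x)
    where
    go : ∀ x .{{_ : NonZero x}} → Acc _<_ x → ∃[ m ] ∃[ e ] Block m e x
    go x (acc rec) with x <? b
    ... | yes x<b = 0 , x , block (>-nonZero⁻¹ x) x<b
                      (≤-reflexive (*-identityʳ x)) (≤-reflexive (sym (*-identityʳ (suc x))))
    ... | no x≮b with go (x / b) {{x/b≢0}} (rec (m/n<m x b (nonTrivial⇒n>1 b)))
      where
      x/b≢0 : NonZero (x / b)
      x/b≢0 = >-nonZero (m≥n⇒m/n>0 (≮⇒≥ x≮b))
    ... | m , e , bx = suc m , e , block (positive bx) (digit bx) low up
      where
      open ≤-Reasoning
      shuffle : ∀ e c d → e * (c * d) ≡ e * d * c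
      shuffle = solve-∀
      low : e * (b * b ^ m) ≤ x
      low = begin
        e * (b * b ^ m)  ≡⟨ shuffle e b (b ^ m) ⟩
        e * b ^ m * b    ≤⟨ *-monoˡ-≤ b (lower bx) ⟩
        x / b * b        ≤⟨ m/n*n≤m x b ⟩
        x                ∎
      up : x < suc e * (b * b ^ m)
      up = begin-strict
        x                    ≡⟨ m≡m%n+[m/n]*n x b ⟩
        x % b + x / b * b    <⟨ +-monoˡ-< (x / b * b) (m%n<n x b) ⟩
        suc (x / b) * b      ≤⟨ *-monoˡ-≤ b (upper bx) ⟩
        suc e * b ^ m * b    ≡⟨ shuffle (suc e) b (b ^ m) ⟨
        suc e * (b * b ^ m)  ∎

  block-level-≤ : ∀ {m e m′ e′ x} → Block m e x → Block m′ e′ x → m ≤ m′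
  block-level-≤ {m} {e} {m′} {e′} {x} bx bx′ = ≮⇒≥ λ m′<m → n≮n x (begin-strict
    x                <⟨ upper bx′ ⟩
    suc e′ * b ^ m′  ≤⟨ *-monoˡ-≤ (b ^ m′) (digit bx′) ⟩
    b ^ suc m′       ≤⟨ ^-monoʳ-≤ b m′<m ⟩
    b ^ m            ≡⟨ *-identityˡ (b ^ m) ⟨
    1 * b ^ m        ≤⟨ *-monoˡ-≤ (b ^ m) (positive bx) ⟩
    e * b ^ m        ≤⟨ lower bx ⟩
    x                ∎)
    where open ≤-Reasoning

  block-digit-≤ : ∀ {m e e′ x} → Block m e x → Block m e′ x → e ≤ e′
  block-digit-≤ {m} {e} {e′} bx bx′ =
    s≤s⁻¹ (*-cancelʳ-< (b ^ m) e (suc e′) (≤-<-trans (lower bx) (upper bx′)))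

  block-unique : ∀ {m e m′ e′ x} → Block m e x → Block m′ e′ x → m ≡ m′ × e ≡ e′
  block-unique bx bx′ with ≤-antisym (block-level-≤ bx bx′) (block-level-≤ bx′ bx)
  ... | refl = refl , ≤-antisym (block-digit-≤ bx bx′) (block-digit-≤ bx′ bx)

  -- If `suc e` is still a digit, the new block has digit `suc e` at level `m`; otherwise `suc e` is
  -- `b` and it has digit 1 at level `suc m`. Either way the old block ends where the new one
  -- starts.
  next-block : ∀ {m e m′ e′ y} → 0 < e → e < b → Block m′ e′ y →
               suc e * b ^ m ≤ y → y < suc (suc e) * b ^ m →
               m ≤ m′ × suc e * b ^ m ≡ e′ * b ^ m′
  next-block {m} {e} 0<e e<b by low up with m<1+n⇒m<n∨m≡n {suc e} {b} (s≤s e<b)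
  ... | inj₁ 1+e<b with block-unique {m} {suc e} (block (s≤s z≤n) 1+e<b low up) by
  ...   | refl , refl = ≤-refl , refl
  next-block {m} {e} 0<e e<b by low up | inj₂ refl
    with block-unique {suc m} {1} (block (s≤s z≤n) (s≤s 0<e) (≤-trans (≤-reflexive (*-identityˡ (b ^ suc m))) low)
           (<-≤-trans up top)) by
    where
    top : suc (suc e) * b ^ m ≤ 2 * b ^ suc m
    top = begin
      b ^ m + b ^ suc m        ≤⟨ +-monoˡ-≤ (b ^ suc m) (m≤n*m (b ^ m) b) ⟩
      b ^ suc m + b ^ suc m    ≡⟨ cong (b ^ suc m +_) (+-identityʳ (b ^ suc m)) ⟨
      2 * b ^ suc m            ∎
      where open ≤-Reasoning
  ...   | refl , refl = n≤1+n m , sym (*-identityˡ (b ^ suc m))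

  -- Comma steps as arithmetic.

  step : ℕ → ℕ → ℕ
  step e x = x + (x % b * b + e)

  -- The comma-child relation with the digit expansion of `y` replaced by its block; the digit `e`
  -- belongs to the target, not the source.
  Edge : ℕ → ℕ → Set
  Edge x y = ∃[ m ] ∃[ e ] Block m e y × y ≡ step e x

  _⟶*_ : ℕ → ℕ → Set
  _⟶*_ = Star Edge

  _⟶⁺_ : ℕ → ℕ → Set
  x ⟶⁺ y = ∃[ z ] Edge x z × z ⟶* y

  x≢y⇒⟶*⇒⟶⁺ : ∀ {x y} → x ≢ y → x ⟶* y → x ⟶⁺ y
  x≢y⇒⟶*⇒⟶⁺ x≢y ε         = contradiction refl x≢y
  x≢y⇒⟶*⇒⟶⁺ x≢y (xz ◅ zy) = _ , xz , zy

  -- The lowest digit is `x % b`, and `x / b` satisfies the same bounds one level down.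
  fromDigits-∷ʳ : ∀ m (e : Digit b) x → toℕ e * b ^ m ≤ x → x < suc (toℕ e) * b ^ m →
                  Σ[ ds ∈ Expansion b ] fromDigits (ds ∷ʳ e) ≡ x
  fromDigits-∷ʳ zero e x low up = [] , (begin
      toℕ e + 0        ≡⟨ +-identityʳ (toℕ e) ⟩
      toℕ e            ≡⟨ ≤-antisym
                            (subst (_≤ x) (*-identityʳ (toℕ e)) low)
                            (s≤s⁻¹ (subst (x <_) (*-identityʳ (suc (toℕ e))) up)) ⟩
      x                ∎)
    where open ≡-Reasoning
  fromDigits-∷ʳ (suc m) e x low up with fromDigits-∷ʳ m e (x / b) low′ up′
    where
    shuffle : ∀ e c d → e * (c * d) ≡ e * d * c
    shuffle = solve-∀
    low′ : toℕ e * b ^ m ≤ x / b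
    low′ = subst (_≤ x / b) (m*n/n≡m (toℕ e * b ^ m) b)
             (/-monoˡ-≤ b (subst (_≤ x) (shuffle (toℕ e) b (b ^ m)) low))
    up′ : x / b < suc (toℕ e) * b ^ m
    up′ = m<n*o⇒m/o<n (subst (x <_) (shuffle (suc (toℕ e)) b (b ^ m)) up)
  ... | ds , eq = fromℕ< (m%n<n x b) ∷ ds ,
    trans (cong₂ (λ d q → d + q * b) (toℕ-fromℕ< (m%n<n x b)) eq) (sym (m≡m%n+[m/n]*n x b))

  edge⇒commaChild : ∀ {x y} → Edge x y → CommaChild b x y
  edge⇒commaChild {x} {y} (m , e , block 0<e e<b low up , refl) with fromℕ< e<b | toℕ-fromℕ< e<b
  ... | d | refl = d , (>-nonZero 0<e , fromDigits-∷ʳ m d y low up) , refl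

  step-bound : ∀ {e} → e < b → ∀ x → step e x < x + b * b
  step-bound {e} e<b x = +-monoʳ-< x (begin-strict
    x % b * b + e    <⟨ +-monoʳ-< (x % b * b) e<b ⟩
    x % b * b + b    ≡⟨ +-comm (x % b * b) b ⟩
    suc (x % b) * b  ≤⟨ *-monoˡ-≤ b (m%n<n x b) ⟩
    b * b            ∎)
    where open ≤-Reasoning

  step-≤ : ∀ e x → x ≤ step e x
  step-≤ e x = m≤m+n x _

  -- The increment depends only on `e` and the last digit of `x`, which a multiple of `b` leaves
  -- alone.
  step-+ : ∀ e x {t} → b ∣ t → step e (x + t) ≡ step e x + t
  step-+ e x {t} b∣t = begin
    x + t + ((x + t) % b * b + e)  ≡⟨ cong (λ d → x + t + (d * b + e)) (%-remove-+ʳ x b∣t) ⟩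
    x + t + (x % b * b + e)        ≡⟨ shuffle x t (x % b * b + e) ⟩
    x + (x % b * b + e) + t        ∎
    where
    open ≡-Reasoning
    shuffle : ∀ x t s → x + t + s ≡ x + s + t
    shuffle = solve-∀

  edge-+ : ∀ {m e x t} → b ∣ t → Block m e (step e x + t) → Edge (x + t) (step e x + t)
  edge-+ {m} {e} {x} b∣t by = m , e , by , sym (step-+ e x b∣t)

  -- Repeated steps with a fixed leading digit.

  steps : ℕ → ℕ → ℕ → ℕ
  steps e x = fold x (step e)

  steps-≤ : ∀ e x j → x ≤ steps e x j
  steps-≤ e x zero    = ≤-refl
  steps-≤ e x (suc j) = ≤-trans (steps-≤ e x j) (step-≤ e _)

  steps-path : ∀ {m e x} j → Block m e x → steps e x j < suc e * b ^ m → x ⟶* steps e x j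
  steps-path zero bx up = ε
  steps-path {m} {e} {x} (suc j) bx up =
    steps-path j bx (≤-<-trans (step-≤ e _) up) ◅◅
    (m , e , block (positive bx) (digit bx) (≤-trans (lower bx) (steps-≤ e x (suc j))) up , refl) ◅ ε

  steps-+ : ∀ e x {t} → b ∣ t → ∀ j → steps e (x + t) j ≡ steps e x j + t
  steps-+ e x b∣t zero    = refl
  steps-+ e x b∣t (suc j) = trans (cong (step e) (steps-+ e x b∣t j)) (step-+ e (steps e x j) b∣t)

  steps-bound : ∀ {e} → e < b → ∀ x j → steps e x j ≤ x + j * (b * b)
  steps-bound e<b x zero = m≤m+n x 0
  steps-bound {e} e<b x (suc j) = begin
    step e (steps e x j)      ≤⟨ <⇒≤ (step-bound e<b (steps e x j)) ⟩
    steps e x j + b * b       ≤⟨ +-monoˡ-≤ (b * b) (steps-bound e<b x j) ⟩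
    x + j * (b * b) + b * b   ≡⟨ shuffle x (j * (b * b)) (b * b) ⟩
    x + (b * b + j * (b * b)) ∎
    where
    open ≤-Reasoning
    shuffle : ∀ x t s → x + t + s ≡ x + (s + t)
    shuffle = solve-∀

  steps-form : ∀ e x j → ∃[ t ] steps e x j ≡ x + (j * e + t * b)
  steps-form e x zero = 0 , sym (+-identityʳ x)
  steps-form e x (suc j) with steps e x j | steps-form e x j
  ... | y | t , eq = t + y % b , (begin
    y + (y % b * b + e)                      ≡⟨ cong (_+ (y % b * b + e)) eq ⟩
    x + (j * e + t * b) + (y % b * b + e)    ≡⟨ shuffle x (j * e) t b (y % b) e ⟩
    x + (e + j * e + (t + y % b) * b)        ∎)
    where
    open ≡-Reasoning
    shuffle : ∀ x u t b d e → x + (u + t * b) + (d * b + e) ≡ x + (e + u + (t + d) * b)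
    shuffle = solve-∀

  -- By `steps-form` the total increment is `b * e` plus a multiple of `b`, so the last digit recurs
  -- after `b` steps. It is nonzero because `e` is, and each step adds at most `b * b`.
  cycle : ∀ {e} → 0 < e → e < b → ∀ x →
          ∃[ l ] steps e x b ≡ x + l × b ∣ l × NonZero l × l ≤ b * (b * b)
  cycle {e} 0<e e<b x with steps-form e x b
  ... | t , eq = b * e + t * b , eq , ∣m∣n⇒∣m+n (m∣m*n e) (n∣m*n t) ,
    >-nonZero (<-≤-trans (*-mono-< (>-nonZero⁻¹ b) 0<e) (m≤m+n (b * e) (t * b))) ,
    +-cancelˡ-≤ x _ _ (subst (_≤ x + b * (b * b)) eq (steps-bound e<b x b))

  cycles : ∀ {e x l} → b ∣ l → steps e x b ≡ x + l → ∀ c → steps e x (c * b) ≡ x + c * l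
  cycles {x = x} b∣l eq zero = sym (+-identityʳ x)
  cycles {e} {x} {l} b∣l eq (suc c) = begin
    steps e x (b + c * b)              ≡⟨ fold-+ x (step e) b ⟩
    steps e (steps e x (c * b)) b      ≡⟨ cong (λ y → steps e y b) (cycles b∣l eq c) ⟩
    steps e (x + c * l) b              ≡⟨ steps-+ e x (∣n⇒∣m*n c b∣l) b ⟩
    steps e x b + c * l                ≡⟨ cong (_+ c * l) eq ⟩
    x + l + c * l                      ≡⟨ +-assoc x l (c * l) ⟩
    x + (l + c * l)                    ∎
    where open ≡-Reasoning

  -- A common multiple of all increments that `cycle` can produce, whatever `e` and `x`.
  M : ℕ
  M = (b * (b * b)) !

  private instance
    M≢0 : NonZero M
    M≢0 = (b * (b * b)) !≢0

  -- The increment `l` of `cycle` divides `M`, so `d` is `c * l` and `c * b` steps end at `x + d`.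
  -- Steps never decrease, so an endpoint inside the block keeps the whole run inside it.
  run : ∀ {m e x d} → M ∣ d → Block m e x → x + d < suc e * b ^ m → x ⟶* (x + d)
  run {m} {e} {x} M∣d bx up with cycle (positive bx) (digit bx) x
  ... | l , eq , b∣l , l≢0 , l≤ with ∣-trans (m≤n⇒m∣n! {{l≢0}} l≤) M∣d
  ... | divides c refl = subst (x ⟶*_) eq′ (steps-path (c * b) bx (subst (_< suc e * b ^ m) (sym eq′) up))
    where
    eq′ : steps e x (c * b) ≡ x + c * l
    eq′ = cycles b∣l eq c

  -- Walking backwards.

  parent : ∀ y → b * b ≤ y → ∃[ x ] Edge x y × y < x + b * b
  parent y b²≤y with block-exists y {{>-nonZero (<-≤-trans (*-mono-< (>-nonZero⁻¹ b) (>-nonZero⁻¹ b)) b²≤y)}}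
  ... | m , e , by = x , (m , e , by , sym y≡) , subst (_< x + b * b) y≡ (step-bound (digit by) x)
    where
    -- Once `e` is removed, subtracting a multiple of `b` keeps the last digit, so `d` is also the
    -- last digit of `x`. The bound `b * b ≤ y` keeps both subtractions exact.
    w = y ∸ e
    d = w % b
    x = w ∸ d * b
    open ≡-Reasoning
    e+db≤y : e + d * b ≤ y
    e+db≤y = ≤-trans (≤-trans (+-monoˡ-≤ (d * b) (<⇒≤ (digit by))) (*-monoˡ-≤ b (m%n<n w b))) b²≤y
    e≤y : e ≤ y
    e≤y = ≤-trans (m≤m+n e (d * b)) e+db≤y
    db≤w : d * b ≤ w
    db≤w = ≤-trans (≤-reflexive (sym (m+n∸m≡n e (d * b)))) (∸-monoˡ-≤ e e+db≤y)
    x%b≡d : x % b ≡ d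
    x%b≡d = m*n≤o⇒[o∸m*n]%n≡o%n d db≤w
    y≡ : step e x ≡ y
    y≡ = begin
      x + (x % b * b + e)  ≡⟨ cong (λ d → x + (d * b + e)) x%b≡d ⟩
      x + (d * b + e)      ≡⟨ +-assoc x (d * b) e ⟨
      x + d * b + e        ≡⟨ cong (_+ e) (m∸n+n≡m db≤w) ⟩
      w + e                ≡⟨ m∸n+n≡m e≤y ⟩
      y                    ∎

  -- Backward steps are shorter than `b * b`, so the walk cannot jump over the window of that width
  -- above `B`.
  ancestor-near : ∀ B y → B ≤ y → ∃[ s ] s < b * b × (B + s) ⟶* y
  ancestor-near B y = go y (<-wellFounded y)
    where
    go : ∀ y → Acc _<_ y → B ≤ y → ∃[ s ] s < b * b × (B + s) ⟶* y
    go y (acc rec) B≤y with y <? B + b * b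
    ... | yes y< = y ∸ B , +-cancelˡ-< B _ _ (subst (_< B + b * b) (sym (m+[n∸m]≡n B≤y)) y<) ,
                   subst (_⟶* y) (sym (m+[n∸m]≡n B≤y)) ε
    ... | no y≮ with parent y (≤-trans (m≤n+m (b * b) B) (≮⇒≥ y≮))
    ... | x , xy@(m , e , by , eq) , y<x+b² with go x (rec x<y) (+-cancelʳ-≤ (b * b) B x (<⇒≤ (≤-<-trans (≮⇒≥ y≮) y<x+b²)))
      where
      x<y : x < y
      x<y = subst (x <_) (sym eq) (m<m+n x (<-≤-trans (positive by) (m≤n+m e (x % b * b))))
    ... | s , s< , path = s , s< , path ◅◅ xy ◅ ε

  -- Pigeonhole along the powers of `b`.

  level : ℕ → ℕ → ℕ
  -- Levels fall as `i` grows because the walk goes backwards; the 2 keeps every power at least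
  -- `b * b`.
  level K i = 2 + (K ∸ i)

  -- Offsets above successive powers met by one backward walk from `b ^ (2 + K)`. Only the offset is
  -- kept; `descent-step` recovers the path from the same call of `ancestor-near`.
  descent : ∀ K i → ∃[ s ] s < b * b
  descent-below : ∀ K i → b ^ level K (suc i) ≤ b ^ level K i + proj₁ (descent K i)

  descent K zero    = 0 , *-mono-< (>-nonZero⁻¹ b) (>-nonZero⁻¹ b)
  descent K (suc i) with ancestor-near (b ^ level K (suc i)) _ (descent-below K i)
  ... | s , s< , _ = s , s<

  descent-below K i = ≤-trans (^-monoʳ-≤ b (+-monoʳ-≤ 2 (∸-monoʳ-≤ K (n≤1+n i)))) (m≤m+n _ _)

  node : ℕ → ℕ → ℕ
  node K i = b ^ level K i + proj₁ (descent K i)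

  descent-step : ∀ K i → node K (suc i) ⟶* node K i
  descent-step K i with ancestor-near (b ^ level K (suc i)) _ (descent-below K i)
  ... | _ , _ , path = path

  descent-path : ∀ K {i j} → i ≤′ j → node K j ⟶* node K i
  descent-path K ≤′-refl       = ε
  descent-path K (≤′-step i≤j) = descent-step K _ ◅◅ descent-path K i≤j

  offset : ℕ → ℕ → Fin (b * b)
  offset K i = fromℕ< (proj₂ (descent K i))

  residue : ℕ → ℕ → Fin M
  residue K i = fromℕ< (m%n<n (b ^ level K i) M)

  repeated-state : ∃[ n ] ∃[ P ] ∃[ s ] 2 ≤ n × 0 < P × s < b * b ×
                   b ^ (n + P) % M ≡ b ^ n % M × (b ^ n + s) ⟶* (b ^ (n + P) + s)
  repeated-state with pigeonhole (n<1+n (b * b * M))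
                        (λ i → combine (offset (b * b * M) (toℕ i)) (residue (b * b * M) (toℕ i)))
  ... | i , j , i<j , eq with combine-injective (offset (b * b * M) (toℕ i)) (residue (b * b * M) (toℕ i))
                                (offset (b * b * M) (toℕ j)) (residue (b * b * M) (toℕ j)) eq
  ... | eqˢ , eqʳ =
    n , n′ ∸ n , s , s≤s (s≤s z≤n) , m<n⇒0<n∸m n<n′ , proj₂ (descent K (toℕ j)) ,
    trans (cong (λ k → b ^ k % M) n+P≡n′) (fromℕ<-injective _ _ _ _ eqʳ) ,
    subst₂ (λ k r → (b ^ n + s) ⟶* (b ^ k + r)) (sym n+P≡n′) (fromℕ<-injective _ _ _ _ eqˢ)
      (descent-path K (≤⇒≤′ (<⇒≤ i<j)))
    where
    -- There are `b * b * M` pairs of offset and residue, and the indices 0 to `K` are one more.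
    K = b * b * M
    n = level K (toℕ j)
    n′ = level K (toℕ i)
    s = proj₁ (descent K (toℕ j))
    n<n′ : n < n′
    n<n′ = +-monoʳ-< 2 (∸-monoʳ-< i<j (toℕ≤pred[n] j))
    n+P≡n′ : n + (n′ ∸ n) ≡ n′
    n+P≡n′ = m+[n∸m]≡n (<⇒≤ n<n′)

  -- Writing `b ^ P` as `suc Q` turns the difference of `b ^ (m + P)` and `b ^ m` into `b ^ m * Q`,
  -- free of truncated subtraction.
  recurrence : ∃[ n ] ∃[ P ] ∃[ Q ] ∃[ s ] 2 ≤ n × 0 < Q × s < b * b ×
               b ^ P ≡ suc Q × M ∣ b ^ n * Q × (b ^ n + s) ⟶* (b ^ (n + P) + s)
  recurrence with repeated-state
  ... | n , P , s , 2≤n , 0<P , s<b² , eq , path = n , P , Q , s , 2≤n , 0<Q , s<b² , b^P≡1+Q , M∣ , path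
    where
    Q = pred (b ^ P)
    1<b^P : 1 < b ^ P
    1<b^P = ^-monoʳ-< b (nonTrivial⇒n>1 b) 0<P
    b^P≡1+Q : b ^ P ≡ suc Q
    b^P≡1+Q = sym (suc-pred (b ^ P) {{>-nonZero (<⇒≤ 1<b^P)}})
    0<Q : 0 < Q
    0<Q = s≤s⁻¹ (subst (1 <_) b^P≡1+Q 1<b^P)
    M∣ : M ∣ b ^ n * Q
    M∣ = [m+n]%d≡m%d⇒d∣n (b ^ n) _ M (trans (cong (_% M) (begin
        b ^ n + b ^ n * Q  ≡⟨ *-suc (b ^ n) Q ⟨
        b ^ n * suc Q      ≡⟨ cong (b ^ n *_) b^P≡1+Q ⟨
        b ^ n * b ^ P      ≡⟨ ^-distribˡ-+-* b n P ⟨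
        b ^ (n + P)        ∎)) eq)
      where open ≡-Reasoning

  -- Raising exponents by `P`.

  module Periodic (n P Q : ℕ) (2≤n : 2 ≤ n) (b^P≡1+Q : b ^ P ≡ suc Q) (M∣ : M ∣ b ^ n * Q) where

    shift : ℕ → ℕ
    shift m = b ^ m * Q

    b^[m+P] : ∀ m → b ^ (m + P) ≡ b ^ m + shift m
    b^[m+P] m = begin
      b ^ (m + P)      ≡⟨ ^-distribˡ-+-* b m P ⟩
      b ^ m * b ^ P    ≡⟨ cong (b ^ m *_) b^P≡1+Q ⟩
      b ^ m * suc Q    ≡⟨ *-suc (b ^ m) Q ⟩
      b ^ m + shift m  ∎
      where open ≡-Reasoning

    e*b^[m+P] : ∀ e m → e * b ^ (m + P) ≡ e * b ^ m + e * shift m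
    e*b^[m+P] e m = trans (cong (e *_) (b^[m+P] m)) (*-distribˡ-+ e (b ^ m) (shift m))

    M∣shift : ∀ {m} → n ≤ m → M ∣ shift m
    M∣shift {m} n≤m = ∣-trans M∣ (*-monoˡ-∣ Q (m≤n⇒b^m∣b^n n≤m))
      where
      m≤n⇒b^m∣b^n : ∀ {m n} → m ≤ n → b ^ m ∣ b ^ n
      m≤n⇒b^m∣b^n {m} {n} m≤n = subst (b ^ m ∣_)
        (trans (sym (^-distribˡ-+-* b m (n ∸ m))) (cong (b ^_) (m+[n∸m]≡n m≤n))) (m∣m*n (b ^ (n ∸ m)))

    b∣shift : ∀ {m} → n ≤ m → b ∣ shift m
    b∣shift n≤m = ∣-trans (m≤n⇒m∣n! (m≤m*n b (b * b) {{m*n≢0 b b}})) (M∣shift n≤m)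

    b²≤b^m : ∀ {m} → n ≤ m → b * b ≤ b ^ m
    b²≤b^m {m} n≤m = subst (_≤ b ^ m) (cong (b *_) (*-identityʳ b)) (^-monoʳ-≤ b (≤-trans 2≤n n≤m))

    -- From level `m` to `m + P` the lower end of the block moves by `e * shift m` and the upper end
    -- by `suc e * shift m`; any translation in between fits.
    block-shift : ∀ {m e y t} → Block m e y → e * shift m ≤ t → t ≤ suc e * shift m → Block (m + P) e (y + t)
    block-shift {m} {e} {y} {t} by lo hi = block (positive by) (digit by)
      (subst (_≤ y + t) (sym (e*b^[m+P] e m)) (+-mono-≤ (lower by) lo))
      (subst (y + t <_) (sym (e*b^[m+P] (suc e) m)) (+-mono-<-≤ (upper by) hi))

    -- The image of x keeps its leading digit e and its distance to the block end (e + 1) bᵐ.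
    Image : ℕ → ℕ → Set
    Image x x′ = ∃[ m ] ∃[ e ] n ≤ m × Block m e x × x′ ≡ x + suc e * shift m

    -- An edge within a block is just translated. An edge into the next block is translated too, and
    -- then `run` restores the distance to the new block end.
    simulate : ∀ {x x′ y} → Image x x′ → Edge x y → ∃[ y′ ] x′ ⟶⁺ y′ × Image y y′
    simulate {x} (m , e , n≤m , bx , refl) (m′ , e′ , by , refl) with step e′ x <? suc e * b ^ m
    ... | yes y<
      with block-unique {m} {e} (block (positive bx) (digit bx) (≤-trans (lower bx) (step-≤ e′ x)) y<) by
    ...   | refl , refl = _ ,
      (_ , edge-+ {x = x} (∣n⇒∣m*n (suc e) (b∣shift n≤m)) (block-shift by (*-monoˡ-≤ (shift m) (n≤1+n e)) ≤-refl) , ε) ,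
      m , e , n≤m , by , refl
    simulate {x} (m , e , n≤m , bx , refl) (m′ , e′ , by , refl) | no y≮
      with next-block (positive bx) (digit bx) by (≮⇒≥ y≮) y<
      where
      -- A step is shorter than `b ^ m`, so it overshoots the block end by less than `b ^ m`.
      y< : step e′ x < suc (suc e) * b ^ m
      y< = begin-strict
        step e′ x              <⟨ step-bound (digit by) x ⟩
        x + b * b              ≤⟨ +-mono-≤ (<⇒≤ (upper bx)) (b²≤b^m n≤m) ⟩
        suc e * b ^ m + b ^ m  ≡⟨ +-comm (suc e * b ^ m) (b ^ m) ⟩
        suc (suc e) * b ^ m    ∎
        where open ≤-Reasoning
    -- The translated edge moves `y` by `e′ * shift m′`, while its image needs `suc e′ * shift m′`;
    -- the missing `shift m′` is a multiple of `M`.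
    ... | m≤m′ , boundary = _ ,
      (_ , edge-+ {x = x} (∣n⇒∣m*n (suc e) (b∣shift n≤m)) (subst (λ t → Block (m′ + P) e′ (y + t)) (sym same) bz) ,
        subst₂ _⟶*_ (cong (y +_) (sym same)) regroup (run (M∣shift n≤m′) bz
          (subst (_< suc e′ * b ^ (m′ + P)) (sym regroup) (upper (block-shift by (*-monoˡ-≤ (shift m′) (n≤1+n e′)) ≤-refl))))) ,
      m′ , e′ , n≤m′ , by , refl
      where
      y = step e′ x
      n≤m′ : n ≤ m′
      n≤m′ = ≤-trans n≤m m≤m′
      same : suc e * shift m ≡ e′ * shift m′
      same = begin
        suc e * (b ^ m * Q)   ≡⟨ *-assoc (suc e) (b ^ m) Q ⟨
        suc e * b ^ m * Q     ≡⟨ cong (_* Q) boundary ⟩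
        e′ * b ^ m′ * Q       ≡⟨ *-assoc e′ (b ^ m′) Q ⟩
        e′ * (b ^ m′ * Q)     ∎
        where open ≡-Reasoning
      bz : Block (m′ + P) e′ (y + e′ * shift m′)
      bz = block-shift by ≤-refl (*-monoˡ-≤ (shift m′) (n≤1+n e′))
      regroup : y + e′ * shift m′ + shift m′ ≡ y + suc e′ * shift m′
      regroup = trans (+-assoc y (e′ * shift m′) (shift m′)) (cong (y +_) (+-comm (e′ * shift m′) (shift m′)))

    -- The invariant of the infinite path; the path to the image is nonempty so that it always
    -- supplies a next node.
    ReachesImage : ℕ → Set
    ReachesImage x = ∃[ x′ ] Image x x′ × x ⟶⁺ x′

    -- The first edge from `x` to `y` is replayed from `x′`: the rest of the old path followed by
    -- the replay leads from `y` to its image.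
    continue : ∀ {x} → ReachesImage x → ∃[ y ] Edge x y × ReachesImage y
    continue (x′ , φx , y , xy , path) with simulate φx xy
    ... | y′ , x′y′ , φy = y , xy , y′ , φy , (path ⟶*∘⟶⁺ x′y′)
      where
      _⟶*∘⟶⁺_ : ∀ {x y z} → x ⟶* y → y ⟶⁺ z → x ⟶⁺ z
      ε         ⟶*∘⟶⁺ yz             = yz
      (xw ◅ wy) ⟶*∘⟶⁺ (v , yv , vz) = _ , xw , (wy ◅◅ yv ◅ vz)

    -- The given path preserves the distance to the block start, whereas an image preserves the
    -- distance to the block end; `run` adds the missing `shift n`.
    start : ∀ {s} → 0 < Q → s < b * b → (b ^ n + s) ⟶* (b ^ (n + P) + s) → ReachesImage (b ^ n + s)
    start {s} 0<Q s<b² path = _ , (n , 1 , ≤-refl , bx , refl) ,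
      x≢y⇒⟶*⇒⟶⁺ (<⇒≢ (m<m+n (b ^ n + s) (<-≤-trans (*-mono-< (b^m>0 n) 0<Q) (m≤m+n (shift n) _))))
        (path ◅◅ subst₂ _⟶*_ (sym end≡) regroup (run (M∣shift ≤-refl) bz
          (subst (_< 2 * b ^ (n + P)) (sym regroup) (upper (block-shift bx (*-monoˡ-≤ (shift n) (n≤1+n 1)) ≤-refl)))))
      where
      bx : Block n 1 (b ^ n + s)
      bx = block (s≤s z≤n) (nonTrivial⇒n>1 b)
        (≤-trans (≤-reflexive (*-identityˡ (b ^ n))) (m≤m+n (b ^ n) s))
        (+-monoʳ-< (b ^ n) (<-≤-trans s<b² (≤-trans (b²≤b^m ≤-refl) (m≤m+n (b ^ n) 0))))
      bz : Block (n + P) 1 (b ^ n + s + 1 * shift n)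
      bz = block-shift bx ≤-refl (*-monoˡ-≤ (shift n) (n≤1+n 1))
      end≡ : b ^ (n + P) + s ≡ b ^ n + s + 1 * shift n
      end≡ = trans (cong (_+ s) (b^[m+P] n)) (swap (b ^ n) (shift n) s)
        where
        swap : ∀ x t s → x + t + s ≡ x + s + 1 * t
        swap = solve-∀
      regroup : b ^ n + s + 1 * shift n + shift n ≡ b ^ n + s + 2 * shift n
      regroup = trans (+-assoc (b ^ n + s) (1 * shift n) (shift n)) (cong (b ^ n + s +_) (+-comm (1 * shift n) (shift n)))

  -- Iterating the invariant.

  infinitePath : ∀ {R : ℕ → Set} → (∀ {x} → R x → NonZero x) → (∀ {x} → R x → ∃[ y ] Edge x y × R y) →
                 ∃ R → InfinitePath (ChildGraph b)
  infinitePath {R} R⇒nonZero next init =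
    (λ k → proj₁ (states k) , R⇒nonZero (proj₂ (states k))) ,
    (λ k → edge⇒commaChild {proj₁ (states k)} (proj₁ (proj₂ (next (proj₂ (states k))))))
    where
    advance : ∃ R → ∃ R
    advance (x , r) with next r
    ... | y , _ , r′ = y , r′
    states : ℕ → ∃ R
    states = fold init advance

theorem5p6 : (b : ℕ) → .{{_ : NonTrivial b}} → InfinitePath (ChildGraph b)
theorem5p6 b with recurrence b
... | n , P , Q , s , 2≤n , 0<Q , s<b² , b^P≡1+Q , M∣ , path =
  infinitePath b (λ (_ , (_ , _ , _ , bx , _) , _) → block⇒nonZero b bx) continue (_ , start 0<Q s<b² path)
  where open Periodic b n P Q 2≤n b^P≡1+Q M∣
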